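{- Let $B_2$ be the second Blanuša snark. Its pebbling number satisfies $\pi(B_2) \leq 30$.
   Context: The graph $B_2$ is the simple cubic graph on the 18 vertices $x_1,x_2,x_3,x_4,x_5$, $x_1',x_2',x_3',x_4',x_5'$, $z_1,z_2,z_3,z_4,z_5$, $z_1',z_2',z_5'$ with the following 27 edges: $z_3z_4$, $z_3x_3$, $z_4x_4$, $z_3x_3'$, $z_4x_4'$; $x_3x_5$, $x_3x_1$, $x_4x_2$, $x_4x_1$, $x_2x_5$; $x_3'x_5'$, $x_3'x_1'$, $x_4'x_2'$, $x_4'x_1'$, $x_2'x_5'$; $x_2z_2$, $x_5z_5$, $x_1z_1$, $x_2'z_2'$, $x_5'z_5'$, $x_1'z_1'$; $z_1z_2$, $z_2z_2'$, $z_1z_5$, $z_5z_5'$, $z_1'z_2'$, $z_1'z_5'$. Graph pebbling. A configuration on a graph $G$ is a function $C : V(G) \to \mathbb{N}$ (with $0 \in \mathbb{N}$), where $C(v)$ is the number of pebbles at $v$; its size is $|C| = \sum_{v \in V(G)} C(v)$. A pebbling move removes 2 pebbles from a vertex $v$ (having at least 2 pebbles) and adds 1 pebble to a vertex adjacent to $v$. For $r \in V(G)$, a configuration is $r$-solvable if some (possibly empty) finite sequence of pebbling moves results in at least one pebble on $r$. For a target $r$, $\pi(G,r)$ is the minimum number $t$ such that every configuration with $t$ pebbles is $r$-solvable. The pebbling number is $\pi(G) = \max_{r \in V(G)} \pi(G,r)$, i.e. the minimum $t$ such that every configuration with $t$ pebbles is $r$-solvable for every $r \in V(G)$. -}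

module Defs where

open import Data.Fin using (Fin; #_)
open import Data.Fin.Properties using (_≟_)
open import Data.List.Base using (List; []; _∷_)
open import Data.List.Membership.Propositional using (_∈_)
open import Data.List.Relation.Unary.All using (All; all?; lookup)
open import Data.Nat.Base using (ℕ; suc; _∸_; _≤_)
open import Data.Nat.Properties using (+-0-monoid)
open import Data.Product.Base using (Σ-syntax; ∃-syntax; _×_; _,_)
open import Data.Sum.Base using (_⊎_; inj₁; inj₂; swap)
open import Data.Vec.Functional using (Vector; updateAt)
open import Algebra.Properties.Monoid.Sum +-0-monoid using (sum)
open import Level using (0ℓ)
open import Relation.Binary.Construct.Closure.ReflexiveTransitive using (Star)
open import Relation.Binary.Core using (Rel)
open import Relation.Binary.Definitions using (Symmetric; Irreflexive)
open import Relation.Binary.PropositionalEquality.Core using (_≡_; _≢_; sym)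
open import Relation.Nullary.Decidable.Core using (from-yes; ¬?)

record SimpleGraph (n : ℕ) : Set₁ where
  field
    Adj        : Rel (Fin n) 0ℓ
    adj-sym    : Symmetric Adj
    adj-irrefl : Irreflexive _≡_ Adj

Config : ℕ → Set
Config n = Vector ℕ n

size : ∀ {n} → Config n → ℕ
size C = sum C

module _ {n : ℕ} (G : SimpleGraph n) where
  open SimpleGraph G

  -- The two updates do not interfere, since adjacent vertices are distinct.
  data Move (C : Config n) : Config n → Set where
    move : ∀ {u v} → Adj u v → 2 ≤ C u →
           Move C (updateAt (updateAt C u (_∸ 2)) v suc)

  Solvable : Fin n → Config n → Set
  Solvable r C = ∃[ D ] (Star Move C D × 1 ≤ D r)

  AllSolvable : Fin n → ℕ → Set
  AllSolvable r t = ∀ (C : Config n) → size C ≡ t → Solvable r C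

  -- t = π(G,r)
  IsRootedPebblingNumber : Fin n → ℕ → Set
  IsRootedPebblingNumber r t =
    AllSolvable r t × (∀ s → AllSolvable r s → t ≤ s)

  -- p = π(G), the maximum of π(G,r) over r.  A relation rather than a
  -- function, because π(G,r) need not exist when G is disconnected.
  IsPebblingNumber : ℕ → Set
  IsPebblingNumber p =
    Σ[ π ∈ (Fin n → ℕ) ]
      ( (∀ r → IsRootedPebblingNumber r (π r))
      × (∀ r → π r ≤ p)
      × ∃[ r ] π r ≡ p )

x₁ x₂ x₃ x₄ x₅ x₁′ x₂′ x₃′ x₄′ x₅′ z₁ z₂ z₃ z₄ z₅ z₁′ z₂′ z₅′ : Fin 18
x₁  = # 0
x₂  = # 1
x₃  = # 2
x₄  = # 3
x₅  = # 4
x₁′ = # 5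
x₂′ = # 6
x₃′ = # 7
x₄′ = # 8
x₅′ = # 9
z₁  = # 10
z₂  = # 11
z₃  = # 12
z₄  = # 13
z₅  = # 14
z₁′ = # 15
z₂′ = # 16
z₅′ = # 17

B₂-edges : List (Fin 18 × Fin 18)
B₂-edges =
  (z₃ , z₄) ∷ (z₃ , x₃) ∷ (z₄ , x₄) ∷ (z₃ , x₃′) ∷ (z₄ , x₄′) ∷
  (x₃ , x₅) ∷ (x₃ , x₁) ∷ (x₄ , x₂) ∷ (x₄ , x₁) ∷ (x₂ , x₅) ∷
  (x₃′ , x₅′) ∷ (x₃′ , x₁′) ∷ (x₄′ , x₂′) ∷ (x₄′ , x₁′) ∷ (x₂′ , x₅′) ∷
  (x₂ , z₂) ∷ (x₅ , z₅) ∷ (x₁ , z₁) ∷ (x₂′ , z₂′) ∷ (x₅′ , z₅′) ∷ (x₁′ , z₁′) ∷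
  (z₁ , z₂) ∷ (z₂ , z₂′) ∷ (z₁ , z₅) ∷ (z₅ , z₅′) ∷ (z₁′ , z₂′) ∷ (z₁′ , z₅′) ∷
  []

B₂-edges-loopless : All (λ (u , v) → u ≢ v) B₂-edges
B₂-edges-loopless = from-yes (all? (λ (u , v) → ¬? (u ≟ v)) B₂-edges)

B₂ : SimpleGraph 18
B₂ = record
  { Adj        = λ u v → (u , v) ∈ B₂-edges ⊎ (v , u) ∈ B₂-edges
  ; adj-sym    = swap
  ; adj-irrefl = λ { u≡v (inj₁ e) → lookup B₂-edges-loopless e u≡v
                   ; u≡v (inj₂ e) → lookup B₂-edges-loopless e (sym u≡v) }
  }

{-# OPTIONS --safe #-}

-- Upper bound: a tree strategy for the root r is a tree through r whose
-- non-root vertices carry weights, each vertex not hanging from r weighing at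
-- most half as much as its parent.  Pebbling away from the leaves never lowers
-- the total weight of the pebbles, so a configuration that outweighs the one
-- with a single pebble on each vertex can bring a pebble to r (the weight
-- function lemma).  For each root of B₂ at most four strategies, together
-- giving every other vertex weight at least k and having total weight less
-- than 30 k, show that 30 pebbles suffice.
--
-- Existence: there are finitely many configurations of a given size and every
-- move lowers the size, so "every configuration of size t is r-solvable" is
-- decidable and π(G,r) is the least t satisfying it.

module Submission where

open import Algebra.Properties.Monoid.Sum using (sum-cong-≗)
open import Algebra.Properties.Semiring.Sum using (*-distribˡ-sum)
open import Data.Fin.Base using (Fin; zero; suc)
open import Data.Fin.Properties as Fin using (any?; all?)
open import Data.List.Base as List using (List; []; _∷_; _++_; concat; allFin)
open import Data.List.Extrema.Nat using (argmax; f[xs]≤f[argmax])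
open import Data.List.Membership.Propositional.Properties using (∈-allFin)
open import Data.List.Relation.Unary.All as All using (All; []; _∷_)
open import Data.Nat.Base
open import Data.Nat.Properties
open import Data.Product.Base using (Σ-syntax; ∃-syntax; _×_; _,_; proj₁; proj₂)
open import Data.Product.Properties using (≡-dec)
open import Data.Sum.Base using (_⊎_; inj₁; inj₂; [_,_]′)
open import Data.Unit.Base using (⊤; tt)
open import Data.Vec.Base using (Vec; []; _∷_; lookup)
open import Data.Vec.Functional as Vector using (Vector; updateAt)
open import Data.Vec.Functional.Properties
  using (updateAt-updates; updateAt-minimal; updateAt-updateAt-local; updateAt-id)
open import Function.Base using (_∘_; const; id)
open import Relation.Binary.Construct.Closure.ReflexiveTransitive using (Star; ε; _◅_; _◅◅_)
open import Relation.Binary.Definitions using (Decidable)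
open import Relation.Binary.PropositionalEquality
open import Relation.Nullary.Decidable
  using (Dec; yes; no; from-yes; map′; ¬?; _×-dec_; _⊎-dec_; _→-dec_)
open import Relation.Nullary.Negation using (contradiction)
import Relation.Unary as Unary
import Data.List.Membership.DecPropositional as DecMembership

open import Defs

-- Weighted pebble counts and the effect of a move.

updateAt-cong-≗ : ∀ {n} (i : Fin n) {f : ℕ → ℕ} {C D : Config n} →
                  C ≗ D → updateAt C i f ≗ updateAt D i f
updateAt-cong-≗ zero    {f} C≗D zero    = cong f (C≗D zero)
updateAt-cong-≗ zero        C≗D (suc j) = C≗D (suc j)
updateAt-cong-≗ (suc i)     C≗D zero    = C≗D zero
updateAt-cong-≗ (suc i)     C≗D (suc j) = updateAt-cong-≗ i (C≗D ∘ suc) j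

infix 7 _·_

_·_ : ∀ {n} → Vector ℕ n → Vector ℕ n → ℕ
w · C = size (λ i → w i * C i)

·-congʳ : ∀ {n} (w : Vector ℕ n) {C D} → C ≗ D → w · C ≡ w · D
·-congʳ w C≗D = sum-cong-≗ +-0-monoid (λ i → cong (w i *_) (C≗D i))

·-comm : ∀ {n} (w C : Vector ℕ n) → w · C ≡ C · w
·-comm w C = sum-cong-≗ +-0-monoid (λ i → *-comm (w i) (C i))

const·-size : ∀ {n} k (C : Config n) → const k · C ≡ k * size C
const·-size k C = sym (*-distribˡ-sum +-*-semiring k C)

1·-size : ∀ {n} (C : Config n) → const 1 · C ≡ size C
1·-size C = sum-cong-≗ +-0-monoid (λ i → *-identityˡ (C i))

·-updateAt-+ : ∀ {n} (w C : Vector ℕ n) v k →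
               w · updateAt C v (k +_) ≡ k * w v + w · C
·-updateAt-+ w C zero k = begin
  w zero * (k + C zero) + rest         ≡⟨ cong (_+ rest) (*-distribˡ-+ (w zero) k (C zero)) ⟩
  w zero * k + w zero * C zero + rest  ≡⟨ +-assoc (w zero * k) _ _ ⟩
  w zero * k + w · C                   ≡⟨ cong (_+ w · C) (*-comm (w zero) k) ⟩
  k * w zero + w · C                   ∎
  where
  open ≡-Reasoning
  rest = (w ∘ suc) · (C ∘ suc)
·-updateAt-+ w C (suc v) k = begin
  w₀ + (w ∘ suc) · updateAt (C ∘ suc) v (k +_)    ≡⟨ cong (w₀ +_) (·-updateAt-+ (w ∘ suc) (C ∘ suc) v k) ⟩
  w₀ + (k * w (suc v) + (w ∘ suc) · (C ∘ suc))    ≡⟨ +-assoc w₀ _ _ ⟨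
  w₀ + k * w (suc v) + (w ∘ suc) · (C ∘ suc)      ≡⟨ cong (_+ (w ∘ suc) · (C ∘ suc)) (+-comm w₀ _) ⟩
  k * w (suc v) + w₀ + (w ∘ suc) · (C ∘ suc)      ≡⟨ +-assoc (k * w (suc v)) w₀ _ ⟩
  k * w (suc v) + w · C                           ∎
  where
  open ≡-Reasoning
  w₀ = w zero * C zero

-- Putting the `k` removed pebbles back restores `C`, so this reduces to `·-updateAt-+`.
·-updateAt-∸ : ∀ {n} (w C : Vector ℕ n) u {k} → k ≤ C u →
               k * w u + w · updateAt C u (_∸ k) ≡ w · C
·-updateAt-∸ w C u {k} k≤Cu = begin
  k * w u + w · updateAt C u (_∸ k)            ≡⟨ ·-updateAt-+ w _ u k ⟨
  w · updateAt (updateAt C u (_∸ k)) u (k +_)  ≡⟨ ·-congʳ w restored ⟩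
  w · C                                        ∎
  where
  open ≡-Reasoning
  restored : updateAt (updateAt C u (_∸ k)) u (k +_) ≗ C
  restored i = trans (updateAt-updateAt-local u {h = id} C (m+[n∸m]≡n k≤Cu) i)
                     (updateAt-id u C i)

transfer : ∀ {n} → Config n → Fin n → Fin n → Config n
transfer C u v = updateAt (updateAt C u (_∸ 2)) v suc

-- Both sides are additive, which avoids truncated subtraction. The weighting `const 1` gives the
-- drop in size; the weighting of a strategy gives the gain in `drain`.
·-transfer : ∀ {n} (w C : Vector ℕ n) u v → 2 ≤ C u →
             2 * w u + w · transfer C u v ≡ w v + w · C
·-transfer w C u v 2≤Cu = begin
  2 * w u + w · transfer C u v     ≡⟨ cong (2 * w u +_) (·-updateAt-+ w _ v 1) ⟩
  2 * w u + (1 * w v + w · C₋)     ≡⟨ cong (λ x → 2 * w u + (x + w · C₋)) (*-identityˡ (w v)) ⟩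
  2 * w u + (w v + w · C₋)         ≡⟨ +-assoc (2 * w u) _ _ ⟨
  2 * w u + w v + w · C₋           ≡⟨ cong (_+ w · C₋) (+-comm (2 * w u) _) ⟩
  w v + 2 * w u + w · C₋           ≡⟨ +-assoc (w v) _ _ ⟩
  w v + (2 * w u + w · C₋)         ≡⟨ cong (w v +_) (·-updateAt-∸ w C u 2≤Cu) ⟩
  w v + w · C                      ∎
  where
  open ≡-Reasoning
  C₋ = updateAt C u (_∸ 2)

size-transfer : ∀ {n} (C : Config n) u v → 2 ≤ C u → size (transfer C u v) < size C
-- With unit weights `·-transfer` says that two pebbles leave and one arrives; cancelling one `suc`
-- leaves the strict inequality.
size-transfer C u v 2≤Cu = ≤-reflexive (suc-injective (begin
  2 + size (transfer C u v)           ≡⟨ cong (2 +_) (1·-size (transfer C u v)) ⟨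
  2 + const 1 · transfer C u v        ≡⟨ ·-transfer (const 1) C u v 2≤Cu ⟩
  suc (const 1 · C)                   ≡⟨ cong suc (1·-size C) ⟩
  suc (size C)                        ∎))
  where open ≡-Reasoning

-- Decidability of solvability and least elements.

configs? : ∀ {n} {P : Config n → Set} → (∀ {C D} → C ≗ D → P C → P D) →
           Unary.Decidable P → ∀ t → Dec (∀ C → size C ≡ t → P C)
configs? {zero} resp P? zero =
  map′ (λ p C _ → resp (λ ()) p) (λ p → p Vector.[] refl) (P? Vector.[])
configs? {zero} resp P? (suc t) = yes (λ C ())
configs? {suc n} {P} resp P? t =
  -- The first vertex holds some `a ≤ t` pebbles and the others form a configuration of size
  -- `t ∸ a`. Reassembling head and tail gives `C` only pointwise, hence the use of `resp`.
  map′ to from (allUpTo? slice? (suc t))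
  where
  ∷-cong : ∀ {a} {C D : Config n} → C ≗ D → (a Vector.∷ C) ≗ (a Vector.∷ D)
  ∷-cong C≗D zero    = refl
  ∷-cong C≗D (suc i) = C≗D i

  Slices : Set
  Slices = ∀ {a} → a < suc t → ∀ C → size C ≡ t ∸ a → P (a Vector.∷ C)

  slice? : Unary.Decidable (λ a → ∀ C → size C ≡ t ∸ a → P (a Vector.∷ C))
  slice? a = configs? (λ C≗D → resp (∷-cong C≗D)) (λ C → P? (a Vector.∷ C)) (t ∸ a)

  to : Slices → ∀ C → size C ≡ t → P C
  to p C refl = resp (λ { zero → refl ; (suc i) → refl })
    (p (s≤s (m≤m+n (C zero) _)) (C ∘ suc) (sym (m+n∸m≡n (C zero) _)))

  from : (∀ C → size C ≡ t → P C) → Slices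
  from p {a} (s≤s a≤t) C eq = p (a Vector.∷ C) (trans (cong (a +_) eq) (m+[n∸m]≡n a≤t))

-- The known witness `t` bounds the search: each failure of `Q 0` shifts `Q` by one and lowers `t`.
least : ∀ {Q : ℕ → Set} → Unary.Decidable Q → ∀ {t} → Q t →
        ∃[ m ] (Q m × (∀ s → Q s → m ≤ s))
least Q? {t} q with Q? 0
... | yes q₀ = 0 , q₀ , λ _ _ → z≤n
least Q? {zero}  q | no ¬q₀ = contradiction q ¬q₀
least Q? {suc t} q | no ¬q₀ with m , qₘ , min ← least (Q? ∘ suc) q =
  suc m , qₘ , λ { zero q₀ → contradiction q₀ ¬q₀ ; (suc s) qₛ → s≤s (min s qₛ) }

module _ {n : ℕ} (G : SimpleGraph n) where
  open SimpleGraph G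

  -- The same moves are replayed from `D`. This supplies the `resp` argument of `configs?`.
  Solvable-resp-≗ : ∀ {r C D} → C ≗ D → Solvable G r C → Solvable G r D
  Solvable-resp-≗ {r} C≗D (_ , ε , 1≤Cr) = _ , ε , subst (1 ≤_) (C≗D r) 1≤Cr
  Solvable-resp-≗ C≗D (E , move {u} {v} uv 2≤Cu ◅ ms , 1≤Er)
    with F , ms′ , 1≤Fr ← Solvable-resp-≗ (updateAt-cong-≗ v (updateAt-cong-≗ u C≗D)) (E , ms , 1≤Er)
    = F , move uv (subst (2 ≤_) (C≗D u) 2≤Cu) ◅ ms′ , 1≤Fr

  module _ (adj? : Decidable Adj) (r : Fin n) where

    solvable? : Unary.Decidable (Solvable G r)
    solvable? C = search (size C) C ≤-refl
      where
      Step : Config n → Set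
      Step C = ∃[ u ] ∃[ v ] (Adj u v × Σ[ _ ∈ 2 ≤ C u ] Solvable G r (transfer C u v))

      to : ∀ {C} → 1 ≤ C r ⊎ Step C → Solvable G r C
      to (inj₁ 1≤Cr) = _ , ε , 1≤Cr
      to (inj₂ (_ , _ , uv , 2≤Cu , D , ms , 1≤Dr)) = D , move uv 2≤Cu ◅ ms , 1≤Dr

      from : ∀ {C} → Solvable G r C → 1 ≤ C r ⊎ Step C
      from (_ , ε , 1≤Cr) = inj₁ 1≤Cr
      from (D , move uv 2≤Cu ◅ ms , 1≤Dr) = inj₂ (_ , _ , uv , 2≤Cu , D , ms , 1≤Dr)

      -- The fuel `k` bounds the size. Each move lowers the size, so a legal move with no fuel left
      -- is contradictory.
      search : ∀ k C → size C ≤ k → Dec (Solvable G r C)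
      step? : ∀ k C → size C ≤ k → ∀ u v → Dec (Σ[ _ ∈ 2 ≤ C u ] Solvable G r (transfer C u v))

      search k C |C|≤k = map′ to from
        (1 ≤? C r ⊎-dec any? (λ u → any? (λ v → adj? u v ×-dec step? k C |C|≤k u v)))

      step? k C |C|≤k u v with 2 ≤? C u
      ... | no 2≰Cu = no (2≰Cu ∘ proj₁)
      step? zero C |C|≤0 u v | yes 2≤Cu =
        contradiction (<-≤-trans (size-transfer C u v 2≤Cu) |C|≤0) n≮0
      step? (suc k) C |C|≤1+k u v | yes 2≤Cu =
        map′ (2≤Cu ,_) proj₂ (search k (transfer C u v)
          (≤-pred (<-≤-trans (size-transfer C u v 2≤Cu) |C|≤1+k)))

    allSolvable? : Unary.Decidable (AllSolvable G r)
    allSolvable? = configs? Solvable-resp-≗ solvable?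

-- Tree strategies, the weight function lemma and certificates.

Strategy : ℕ → Set
Strategy n = List (Fin n × Fin n × ℕ)

-- Weights accumulate instead of overwriting, so a concatenation of trees that share vertices weighs
-- the sum of the trees.
weight : ∀ {n} → Strategy n → Vector ℕ n
weight []                = const 0
weight ((c , _ , m) ∷ S) = updateAt (weight S) c (m +_)

·-weight-∷ : ∀ {n} c p m (S : Strategy n) C →
             weight ((c , p , m) ∷ S) · C ≡ m * C c + weight S · C
·-weight-∷ c p m S C = begin
  updateAt (weight S) c (m +_) · C   ≡⟨ ·-comm _ C ⟩
  C · updateAt (weight S) c (m +_)   ≡⟨ ·-updateAt-+ C (weight S) c m ⟩
  m * C c + C · weight S             ≡⟨ cong (m * C c +_) (·-comm C _) ⟩
  m * C c + weight S · C             ∎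
  where open ≡-Reasoning

·-weight-++ : ∀ {n} (S T : Strategy n) C →
              weight (S ++ T) · C ≡ weight S · C + weight T · C
·-weight-++ [] T C = cong (_+ weight T · C) (sym (const·-size 0 C))
·-weight-++ ((c , p , m) ∷ S) T C = begin
  weight ((c , p , m) ∷ S ++ T) · C               ≡⟨ ·-weight-∷ c p m (S ++ T) C ⟩
  m * C c + weight (S ++ T) · C                   ≡⟨ cong (m * C c +_) (·-weight-++ S T C) ⟩
  m * C c + (weight S · C + weight T · C)         ≡⟨ +-assoc (m * C c) _ _ ⟨
  m * C c + weight S · C + weight T · C           ≡⟨ cong (_+ weight T · C) (·-weight-∷ c p m S C) ⟨
  weight ((c , p , m) ∷ S) · C + weight T · C     ∎
  where open ≡-Reasoning

size-mono-≤ : ∀ {n} (C D : Config n) → (∀ i → C i ≤ D i) → size C ≤ size D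
size-mono-≤ {zero}  C D C≤D = z≤n
size-mono-≤ {suc n} C D C≤D = +-mono-≤ (C≤D zero) (size-mono-≤ (C ∘ suc) (D ∘ suc) (C≤D ∘ suc))

module _ {n : ℕ} (G : SimpleGraph n) where
  open SimpleGraph G

  -- Moves along `uv` are repeated while `u` holds two pebbles. Each trades weight `2 * w u` for
  -- `w v`, hence loses nothing; `k` is fuel bounding the pebbles at `u`.
  drain : ∀ {u v} → Adj u v → (w : Vector ℕ n) → 2 * w u ≤ w v → ∀ k C → C u ≤ k →
          ∃[ D ] (Star (Move G) C D × D u ≤ 1 × w · C ≤ w · D)
  drain uv w 2wu≤wv zero C Cu≤0 = C , ε , m≤n⇒m≤1+n Cu≤0 , ≤-refl
  drain {u} {v} uv w 2wu≤wv (suc k) C Cu≤1+k with 2 ≤? C u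
  ... | no 2≰Cu = C , ε , ≤-pred (≰⇒> 2≰Cu) , ≤-refl
  ... | yes 2≤Cu =
    let D , ms , Du≤1 , gain = drain uv w 2wu≤wv k (transfer C u v) C′u≤k in
    D , move uv 2≤Cu ◅ ms , Du≤1 , ≤-trans (+-cancelˡ-≤ (2 * w u) _ _ C≤C′) gain
    where
    open ≤-Reasoning
    C′u≤k : transfer C u v u ≤ k
    C′u≤k = begin
      transfer C u v u          ≡⟨ updateAt-minimal u v _ (λ u≡v → adj-irrefl u≡v uv) ⟩
      updateAt C u (_∸ 2) u     ≡⟨ updateAt-updates u C ⟩
      C u ∸ 2                   ≤⟨ ∸-monoˡ-≤ 2 Cu≤1+k ⟩
      k ∸ 1                     ≤⟨ m∸n≤m k 1 ⟩
      k                         ∎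

    C≤C′ : 2 * w u + w · C ≤ 2 * w u + w · transfer C u v
    C≤C′ = begin
      2 * w u + w · C                  ≤⟨ +-monoˡ-≤ (w · C) 2wu≤wv ⟩
      w v + w · C                      ≡⟨ ·-transfer w C u v 2≤Cu ⟨
      2 * w u + w · transfer C u v     ∎

  -- An entry (c , p , m) hangs the vertex c of weight m below its parent p.
  -- Children precede their parents.
  IsStrategy : Fin n → Strategy n → Set
  IsStrategy r []                = ⊤
  IsStrategy r ((c , p , m) ∷ S) =
    Adj c p × weight S c ≡ 0 × (p ≡ r ⊎ 2 * m ≤ weight S p) × IsStrategy r S

  isStrategy? : Decidable Adj → ∀ r → Unary.Decidable (IsStrategy r)
  isStrategy? adj? r []                = yes tt
  isStrategy? adj? r ((c , p , m) ∷ S) =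
    adj? c p ×-dec weight S c ≟ 0 ×-dec
    (p Fin.≟ r ⊎-dec 2 * m ≤? weight S p) ×-dec isStrategy? adj? r S

  -- Induction leaf by leaf. Once the leaf `c` holds at most one pebble, it contributes at most `m`
  -- to the weight of the configuration and exactly `m` to that of `const 1`, so the strict
  -- inequality survives deleting `c`.
  weight-function-lemma : ∀ {r} S → IsStrategy r S → ∀ C →
                          weight S · const 1 < weight S · C → Solvable G r C
  weight-function-lemma [] _ C total< =
    contradiction (subst₂ _<_ (const·-size {n} 0 (const 1)) (const·-size 0 C) total<) n≮0
  weight-function-lemma {r} ((c , p , m) ∷ S) (cp , Sc≡0 , parent , isS) C total< =
    [ atRoot , inside ]′ parent
    where
    open ≤-Reasoning
    T = (c , p , m) ∷ S

    c≢p : c ≢ p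
    c≢p c≡p = adj-irrefl c≡p cp

    prune : ∀ D → D c ≤ 1 → weight T · C ≤ weight T · D → Solvable G r D
    prune D Dc≤1 gain = weight-function-lemma S isS D (+-cancelˡ-< m _ _ (begin-strict
      m + weight S · const 1         ≡⟨ cong (_+ weight S · const 1) (*-identityʳ m) ⟨
      m * 1 + weight S · const 1     ≡⟨ ·-weight-∷ c p m S (const 1) ⟨
      weight T · const 1             <⟨ total< ⟩
      weight T · C                   ≤⟨ gain ⟩
      weight T · D                   ≡⟨ ·-weight-∷ c p m S D ⟩
      m * D c + weight S · D         ≤⟨ +-monoˡ-≤ _ (*-monoʳ-≤ m Dc≤1) ⟩
      m * 1 + weight S · D           ≡⟨ cong (_+ weight S · D) (*-identityʳ m) ⟩
      m + weight S · D               ∎))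

    -- A child of the root with two pebbles solves at once; otherwise it is already drained. Thus
    -- the root needs no weight.
    atRoot : p ≡ r → Solvable G r C
    atRoot refl with 2 ≤? C c
    ... | yes 2≤Cc = transfer C c p , move cp 2≤Cc ◅ ε ,
                     subst (1 ≤_) (sym (updateAt-updates p _)) (s≤s z≤n)
    ... | no 2≰Cc  = prune C (≤-pred (≰⇒> 2≰Cc)) ≤-refl

    inside : 2 * m ≤ weight S p → Solvable G r C
    inside 2m≤Sp
      with D , ms , Dc≤1 , gain ← drain cp (weight T) (begin
        2 * weight T c          ≡⟨ cong (2 *_) (updateAt-updates c (weight S)) ⟩
        -- As `c` has no weight in `S`, its weight in `T` is exactly `m`, and the halving condition
        -- applies.
        2 * (m + weight S c)    ≡⟨ cong (λ x → 2 * (m + x)) Sc≡0 ⟩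
        2 * (m + 0)             ≡⟨ cong (2 *_) (+-identityʳ m) ⟩
        2 * m                   ≤⟨ 2m≤Sp ⟩
        weight S p              ≡⟨ updateAt-minimal p c (weight S) (c≢p ∘ sym) ⟨
        weight T p              ∎) (C c) C ≤-refl
      with E , ms′ , 1≤Er ← prune D Dc≤1 gain
      = E , ms ◅◅ ms′ , 1≤Er

  -- If every tree failed the hypothesis of `weight-function-lemma`, adding up the failures would
  -- contradict the combined inequality.
  strategies-lemma : ∀ {r} Ss → All (IsStrategy r) Ss → ∀ C →
                     weight (concat Ss) · const 1 < weight (concat Ss) · C → Solvable G r C
  strategies-lemma [] [] = weight-function-lemma [] tt
  strategies-lemma (S ∷ Ss) (isS ∷ isSs) C total< with weight S · const 1 <? weight S · C
  ... | yes S< = weight-function-lemma S isS C S<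
  ... | no  S≮ = strategies-lemma Ss isSs C (≰⇒> λ Ss≥ → <⇒≱ total< (begin
    weight (S ++ concat Ss) · C                                ≡⟨ ·-weight-++ S (concat Ss) C ⟩
    weight S · C + weight (concat Ss) · C                      ≤⟨ +-mono-≤ (≮⇒≥ S≮) Ss≥ ⟩
    weight S · const 1 + weight (concat Ss) · const 1          ≡⟨ ·-weight-++ S (concat Ss) (const 1) ⟨
    weight (S ++ concat Ss) · const 1                          ∎))
    where open ≤-Reasoning

  -- Dividing by `k` gives the fractional form: each vertex other than the root weighs at least 1,
  -- and the total weight is below `t`.
  Certifies : Fin n → ℕ → ℕ × List (Strategy n) → Set
  Certifies r t (k , Ss) =
    All (IsStrategy r) Ss ×
    (∀ v → v ≢ r → k ≤ weight (concat Ss) v) ×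
    weight (concat Ss) · const 1 < k * t

  certifies? : Decidable Adj → ∀ r t → Unary.Decidable (Certifies r t)
  certifies? adj? r t (k , Ss) =
    All.all? (isStrategy? adj? r) Ss ×-dec
    all? (λ v → ¬? (v Fin.≟ r) →-dec k ≤? weight (concat Ss) v) ×-dec
    weight (concat Ss) · const 1 <? k * t

  certified : ∀ {r t} K → Certifies r t K → AllSolvable G r t
  certified {r} (k , Ss) (isSs , cover , total<) C refl with 1 ≤? C r
  ... | yes 1≤Cr = C , ε , 1≤Cr
  ... | no  1≰Cr = strategies-lemma Ss isSs C (begin-strict
    weight (concat Ss) · const 1    <⟨ total< ⟩
    k * size C                      ≡⟨ const·-size k C ⟨
    const k · C                     ≤⟨ size-mono-≤ _ _ pointwise ⟩
    weight (concat Ss) · C          ∎)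
    where
    open ≤-Reasoning
    pointwise : ∀ v → k * C v ≤ weight (concat Ss) v * C v
    pointwise v with v Fin.≟ r
    -- The root may weigh less than `k`, but it is empty here.
    ... | yes refl rewrite n<1⇒n≡0 (≰⇒> 1≰Cr) | *-zeroʳ k = z≤n
    ... | no v≢r = *-monoˡ-≤ (C v) (cover v v≢r)

-- From rooted bounds to the pebbling number.

maximum-attained : ∀ {n} (f : Fin (suc n) → ℕ) → ∃[ i ] (∀ j → f j ≤ f i)
maximum-attained {n} f = argmax f zero (allFin (suc n)) , λ j →
  All.lookup (f[xs]≤f[argmax] {f = f} zero (allFin (suc n))) (∈-allFin j)

-- The witness is the rooted number at a maximising root, whose minimality bounds it by `t`.
pebbling-number-≤ : ∀ {n} (G : SimpleGraph (suc n)) {t} → (∀ r → AllSolvable G r t) →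
                    (∀ r → ∃[ m ] IsRootedPebblingNumber G r m) →
                    ∃[ p ] (IsPebblingNumber G p × p ≤ t)
pebbling-number-≤ G all-solvable rooted with r , maximal ← maximum-attained (proj₁ ∘ rooted) =
  proj₁ (rooted r) ,
  (proj₁ ∘ rooted , proj₂ ∘ rooted , maximal , r , refl) ,
  proj₂ (proj₂ (rooted r)) _ (all-solvable r)

-- Certificates for the second Blanuša snark up to symmetry.

B₂-adj? : Decidable (SimpleGraph.Adj B₂)
B₂-adj? u v = (u , v) ∈? B₂-edges ⊎-dec (v , u) ∈? B₂-edges
  where open DecMembership (≡-dec Fin._≟_ Fin._≟_) using (_∈?_)

Certificate : Set
Certificate = ℕ × List (Strategy 18)

-- When `σ` is an automorphism, a certificate for `r` becomes one for `σ r`, with the same `k` and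
-- total weight.
relabel : (Fin 18 → Fin 18) → Certificate → Certificate
relabel σ (k , Ss) = k , List.map (List.map λ (c , p , m) → σ c , σ p , m) Ss

-- The automorphism group of B₂ is generated by these two involutions.
prime flip : Fin 18 → Fin 18
prime = lookup (x₁′ ∷ x₂′ ∷ x₃′ ∷ x₄′ ∷ x₅′ ∷ x₁ ∷ x₂ ∷ x₃ ∷ x₄ ∷ x₅ ∷
                z₁′ ∷ z₂′ ∷ z₃ ∷ z₄ ∷ z₅′ ∷ z₁ ∷ z₂ ∷ z₅ ∷ [])
flip  = lookup (x₁ ∷ x₅ ∷ x₄ ∷ x₃ ∷ x₂ ∷ x₁′ ∷ x₅′ ∷ x₄′ ∷ x₃′ ∷ x₂′ ∷
                z₁ ∷ z₅ ∷ z₄ ∷ z₃ ∷ z₂ ∷ z₁′ ∷ z₅′ ∷ z₂′ ∷ [])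

-- Solutions of a linear program over the tree strategies, with denominators cleared.
at-x₁ at-x₂ at-x₃ at-z₁ at-z₂ at-z₃ : Certificate
at-x₁ = 20 ,
  ((z₂′ , x₂′ , 2) ∷ (z₁′ , x₁′ , 4) ∷ (x₄′ , x₁′ , 4) ∷ (z₅′ , x₅′ , 4) ∷ (x₂′ , x₅′ , 4) ∷
   (x₁′ , x₃′ , 8) ∷ (x₅′ , x₃′ , 8) ∷ (x₃′ , z₃ , 16) ∷ (z₃ , x₃ , 32) ∷ (x₃ , x₁ , 64) ∷ []) ∷
  ((x₁′ , z₁′ , 5) ∷ (x₅′ , z₅′ , 10) ∷ (z₁′ , z₂′ , 10) ∷ (x₂′ , z₂′ , 10) ∷ (z₅′ , z₅ , 20) ∷
   (x₅ , z₅ , 20) ∷ (z₂′ , z₂ , 20) ∷ (x₂ , z₂ , 20) ∷ (z₅ , z₁ , 40) ∷ (z₂ , z₁ , 40) ∷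
   (z₁ , x₁ , 80) ∷ []) ∷
  ((z₅′ , x₅′ , 2) ∷ (z₁′ , x₁′ , 4) ∷ (x₃′ , x₁′ , 4) ∷ (z₂′ , x₂′ , 4) ∷ (x₅′ , x₂′ , 4) ∷
   (x₁′ , x₄′ , 8) ∷ (x₂′ , x₄′ , 8) ∷ (x₄′ , z₄ , 16) ∷ (z₄ , x₄ , 32) ∷ (x₄ , x₁ , 64) ∷ []) ∷
  ((z₁′ , z₅′ , 2) ∷ (z₅′ , z₅ , 4) ∷ (z₅ , z₁ , 8) ∷ (z₁ , x₁ , 16) ∷ []) ∷
  []

at-x₂ = 8 ,
  ((x₃′ , x₅′ , 2) ∷ (z₅′ , z₁′ , 4) ∷ (x₁′ , z₁′ , 4) ∷ (x₅′ , x₂′ , 4) ∷ (z₁′ , z₂′ , 8) ∷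
   (x₂′ , z₂′ , 8) ∷ (z₂′ , z₂ , 16) ∷ (z₂ , x₂ , 32) ∷ []) ∷
  ((x₅′ , x₃′ , 2) ∷ (x₁′ , x₄′ , 4) ∷ (x₃′ , z₃ , 4) ∷ (z₁ , x₁ , 8) ∷ (x₄′ , z₄ , 8) ∷
   (z₃ , z₄ , 8) ∷ (x₁ , x₄ , 16) ∷ (z₄ , x₄ , 16) ∷ (x₄ , x₂ , 32) ∷ []) ∷
  ((x₁′ , x₃′ , 1) ∷ (x₅′ , z₅′ , 2) ∷ (x₃′ , z₃ , 2) ∷ (z₅′ , z₅ , 4) ∷ (z₁ , z₅ , 4) ∷
   (x₁ , x₃ , 4) ∷ (z₃ , x₃ , 4) ∷ (z₅ , x₅ , 8) ∷ (x₃ , x₅ , 8) ∷ (x₅ , x₂ , 16) ∷ []) ∷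
  []

at-x₃ = 8 ,
  ((z₅′ , z₁′ , 1) ∷ (z₁′ , x₁′ , 2) ∷ (z₂′ , x₂′ , 2) ∷ (x₁′ , x₄′ , 4) ∷ (x₂′ , x₄′ , 4) ∷
   (x₄′ , z₄ , 8) ∷ (x₄ , z₄ , 8) ∷ (z₄ , z₃ , 16) ∷ (z₃ , x₃ , 32) ∷ []) ∷
  ((x₂′ , z₂′ , 1) ∷ (z₁′ , z₅′ , 2) ∷ (z₂′ , z₂ , 2) ∷ (z₅′ , z₅ , 4) ∷ (z₂ , x₂ , 4) ∷
   (x₄ , x₂ , 4) ∷ (z₅ , x₅ , 8) ∷ (x₂ , x₅ , 8) ∷ (x₅ , x₃ , 16) ∷ []) ∷
  ((z₂′ , z₂ , 2) ∷ (z₂ , z₁ , 4) ∷ (z₁ , x₁ , 8) ∷ (x₁ , x₃ , 16) ∷ []) ∷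
  ((z₂′ , x₂′ , 2) ∷ (z₁′ , x₁′ , 4) ∷ (z₅′ , x₅′ , 4) ∷ (x₂′ , x₅′ , 4) ∷ (x₁′ , x₃′ , 8) ∷
   (x₅′ , x₃′ , 8) ∷ (x₃′ , z₃ , 16) ∷ (z₃ , x₃ , 32) ∷ []) ∷
  []

at-z₁ = 8 ,
  ((z₃ , z₄ , 1) ∷ (x₃′ , x₅′ , 2) ∷ (z₄ , x₄′ , 2) ∷ (x₁′ , z₁′ , 4) ∷ (x₅′ , x₂′ , 4) ∷
   (x₄′ , x₂′ , 4) ∷ (z₁′ , z₂′ , 8) ∷ (x₂′ , z₂′ , 8) ∷ (z₂′ , z₂ , 16) ∷ (z₂ , z₁ , 32) ∷ []) ∷
  ((x₁′ , x₃′ , 2) ∷ (x₄′ , z₄ , 4) ∷ (x₃′ , z₃ , 4) ∷ (x₂ , x₄ , 8) ∷ (z₄ , x₄ , 8) ∷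
   (x₅ , x₃ , 8) ∷ (z₃ , x₃ , 8) ∷ (x₄ , x₁ , 16) ∷ (x₃ , x₁ , 16) ∷ (x₁ , z₁ , 32) ∷ []) ∷
  ((x₄′ , x₁′ , 1) ∷ (x₁′ , z₁′ , 2) ∷ (x₃′ , x₅′ , 2) ∷ (z₁′ , z₅′ , 4) ∷ (x₅′ , z₅′ , 4) ∷
   (z₅′ , z₅ , 8) ∷ (z₅ , z₁ , 16) ∷ []) ∷
  []

at-z₂ = 24 ,
  ((x₁′ , x₃′ , 3) ∷ (x₃′ , z₃ , 6) ∷ (z₄ , z₃ , 6) ∷ (x₅′ , z₅′ , 12) ∷ (z₃ , x₃ , 12) ∷
   (z₅′ , z₅ , 24) ∷ (x₅ , z₅ , 24) ∷ (x₃ , x₁ , 24) ∷ (z₅ , z₁ , 48) ∷ (x₁ , z₁ , 48) ∷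
   (z₁ , z₂ , 96) ∷ []) ∷
  ((x₃′ , x₁′ , 6) ∷ (x₁′ , z₁′ , 12) ∷ (z₁′ , z₂′ , 24) ∷ (z₂′ , z₂ , 48) ∷ []) ∷
  ((x₁′ , x₄′ , 4) ∷ (x₃′ , z₃ , 4) ∷ (x₄′ , z₄ , 8) ∷ (z₃ , z₄ , 8) ∷ (z₄ , x₄ , 16) ∷
   (x₄ , x₂ , 32) ∷ (x₂ , z₂ , 64) ∷ []) ∷
  ((x₃ , z₃ , 2) ∷ (z₃ , z₄ , 4) ∷ (x₃′ , x₅′ , 8) ∷ (x₁′ , x₄′ , 8) ∷ (z₄ , x₄′ , 8) ∷
   (x₅′ , x₂′ , 16) ∷ (x₄′ , x₂′ , 16) ∷ (x₂′ , z₂′ , 32) ∷ (z₂′ , z₂ , 64) ∷ []) ∷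
  []

at-z₃ = 10 ,
  ((x₂ , z₂ , 1) ∷ (z₂ , z₂′ , 2) ∷ (z₁ , z₅ , 2) ∷ (z₂′ , z₁′ , 4) ∷ (z₅ , z₅′ , 4) ∷
   (z₁′ , x₁′ , 8) ∷ (z₅′ , x₅′ , 8) ∷ (x₂′ , x₅′ , 8) ∷ (x₁′ , x₃′ , 16) ∷ (x₅′ , x₃′ , 16) ∷
   (x₃′ , z₃ , 32) ∷ []) ∷
  ((x₂′ , z₂′ , 1) ∷ (z₂′ , z₂ , 2) ∷ (z₁′ , z₅′ , 2) ∷ (z₂ , z₁ , 4) ∷ (z₅′ , z₅ , 4) ∷
   (z₁ , x₁ , 8) ∷ (z₅ , x₅ , 8) ∷ (x₂ , x₅ , 8) ∷ (x₁ , x₃ , 16) ∷ (x₅ , x₃ , 16) ∷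
   (x₃ , z₃ , 32) ∷ []) ∷
  ((z₂ , x₂ , 4) ∷ (z₂′ , x₂′ , 4) ∷ (x₂ , x₄ , 8) ∷ (x₂′ , x₄′ , 8) ∷ (x₄ , z₄ , 16) ∷
   (x₄′ , z₄ , 16) ∷ (z₄ , z₃ , 32) ∷ []) ∷
  []

-- Listed in the numbering of the vertices. The symmetries have six orbits, represented by `x₁`,
-- `x₂`, `x₃`, `z₁`, `z₂` and `z₃`.
certificates : Vec Certificate 18
certificates =
  at-x₁ ∷ at-x₂ ∷ at-x₃ ∷ relabel flip at-x₃ ∷ relabel flip at-x₂ ∷
  relabel prime at-x₁ ∷ relabel prime at-x₂ ∷ relabel prime at-x₃ ∷
  relabel prime (relabel flip at-x₃) ∷ relabel prime (relabel flip at-x₂) ∷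
  at-z₁ ∷ at-z₂ ∷ at-z₃ ∷ relabel flip at-z₃ ∷ relabel flip at-z₂ ∷
  relabel prime at-z₁ ∷ relabel prime at-z₂ ∷ relabel prime (relabel flip at-z₂) ∷ []

B₂-certified : ∀ r → Certifies B₂ r 30 (lookup certificates r)
B₂-certified = from-yes (all? λ r → certifies? B₂ B₂-adj? r 30 (lookup certificates r))

theorem3p1 : ∃[ p ] (IsPebblingNumber B₂ p × p ≤ 30)
-- Solvability with 30 pebbles serves twice: as the upper bound, and as the witness from which
-- `least` obtains each rooted number.
theorem3p1 = pebbling-number-≤ B₂ all-solvable λ r → least (allSolvable? B₂ B₂-adj? r) (all-solvable r)
  where
  all-solvable : ∀ r → AllSolvable B₂ r 30
  all-solvable r = certified B₂ (lookup certificates r) (B₂-certified r)
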